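{- Let $n\ge 1$, let $\lambda$ be a partition of $n$, and let $\mu_1=\lambda(c_1\to a_1)$ and $\mu_2=\lambda(c_2\to a_2)$ be obtained from $\lambda$ by admissible transfers, with $\mu_1\neq\mu_2$. Then the vertices $\lambda,\mu_1,\mu_2$ form a triangle in $G_n$ if and only if $c_1=c_2$ or $a_1=a_2$.
   Context: A partition of $n$ is a weakly decreasing sequence $\lambda=(\lambda_1\ge\cdots\ge\lambda_\ell>0)$ of positive integers with sum $n$, identified with its Ferrers diagram ($\lambda_i$ left-justified cells in row $i$); set $\lambda_{\ell+1}=0$. The partition graph $G_n$ has as vertices all partitions of $n$; two distinct partitions are adjacent if one is obtained from the other by removing one cell from a row, adding it to another row (possibly a new row of length $0$), and reordering the row lengths into weakly decreasing order. A triangle is a set of three pairwise adjacent vertices. A removable corner of $\lambda$ is the last cell of a row whose length is strictly greater than that of the next row; an addable corner is a position where a cell can be added so that the result is again a Ferrers diagram of a partition (row $\ell+1$ allowed). Write $r(\cdot)$ for the row number of a corner. For a removable corner $c$ and an addable corner $a$ of $\lambda$ with $r(c)\ne r(a)$, remove $c$ (decrease $\lambda_{r(c)}$ by $1$), add a cell at $a$ (increase $\lambda_{r(a)}$ by $1$), and reorder row lengths. If the result is a partition of $n$ different from $\lambda$, the transfer is called admissible and the result is denoted $\lambda(c\to a)$. The neighbors of $\lambda$ in $G_n$ are exactly the partitions $\lambda(c\to a)$ for admissible transfers. -}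

module Defs where

open import Data.List.Base using (List; []; _∷_; [_]; _++_; length; filter)
open import Data.List.Relation.Binary.Permutation.Propositional using (_↭_)
open import Data.List.Relation.Unary.All using (All)
open import Data.List.Relation.Unary.Linked using (Linked)
open import Data.Nat.Base using (ℕ; zero; suc; pred; _≤_; _<_; _>_; _≥_)
open import Data.Nat.ListAction using (sum)
open import Data.Nat.Properties using (_<?_)
open import Data.Product.Base using (Σ-syntax; ∃-syntax; _×_; _,_; proj₁; proj₂)
open import Data.Sum.Base using (_⊎_)
open import Function.Bundles using (_⇔_)
open import Relation.Binary.PropositionalEquality.Core using (_≡_; _≢_)
open import Relation.Nullary.Negation.Core using (¬_)

-- The three proof fields are proof-irrelevant, so _≡_ on partitions amounts to
-- equality of the lists of parts.
record Partition (n : ℕ) : Set where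
  field
    parts      : List ℕ
    decreasing : Linked _≥_ parts
    positive   : All (_> 0) parts
    sum≡n      : sum parts ≡ n

open Partition public

-- Rows and columns are numbered from 0; rows past the end have length 0.
rowLength : List ℕ → ℕ → ℕ
rowLength []       _       = 0
rowLength (x ∷ _)  zero    = x
rowLength (_ ∷ xs) (suc i) = rowLength xs i

Cell : Set
Cell = ℕ × ℕ

row : Cell → ℕ
row = proj₁

col : Cell → ℕ
col = proj₂

_∈F_ : ∀ {n} → Cell → Partition n → Set
x ∈F κ = col x < rowLength (parts κ) (row x)

-- `suc (col c)` is the length of a row whose last cell is c.
RemovableCorner : ∀ {n} → Partition n → Cell → Set
RemovableCorner κ c =
  suc (col c) ≡ rowLength (parts κ) (row c) ×
  rowLength (parts κ) (row c) > rowLength (parts κ) (suc (row c))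

AddableCorner : ∀ {n} → Partition n → Cell → Set
AddableCorner κ a =
  ¬ (a ∈F κ) ×
  (∃[ m ] Σ[ ν ∈ Partition m ] (∀ x → (x ∈F ν) ⇔ (x ∈F κ ⊎ x ≡ a)))

updateRow : (ℕ → ℕ) → ℕ → List ℕ → List ℕ
updateRow f _       []       = []
updateRow f zero    (x ∷ xs) = f x ∷ xs
updateRow f (suc i) (x ∷ xs) = x ∷ updateRow f i xs

-- The appended 0 is the possible new row, so for a list of ℓ rows the
-- intended range is i < ℓ and j ≤ ℓ.
moveCell : ℕ → ℕ → List ℕ → List ℕ
moveCell i j xs = updateRow suc j (updateRow pred i (xs ++ [ 0 ]))

-- Rows of length 0 are not rows of a partition.  As the parts of μ are weakly
-- decreasing, being a permutation of the remaining lengths says that μ is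
-- obtained by putting them in weakly decreasing order.
_isReorderingOf_ : ∀ {n} → Partition n → List ℕ → Set
μ isReorderingOf xs = parts μ ↭ filter (0 <?_) xs

_⟶_ : ∀ {n} → Partition n → Partition n → Set
κ ⟶ μ = ∃[ i ] ∃[ j ]
  (i < length (parts κ) × j ≤ length (parts κ) × i ≢ j ×
   μ isReorderingOf moveCell i j (parts κ))

-- Adjacency in the partition graph, whose vertex set is Partition n.
_~_ : ∀ {n} → Partition n → Partition n → Set
κ ~ μ = κ ≢ μ × (κ ⟶ μ ⊎ μ ⟶ κ)

Triangle : ∀ {n} → Partition n → Partition n → Partition n → Set
Triangle κ μ ν = κ ~ μ × κ ~ ν × μ ~ ν

-- The transfer of c to a is admissible for κ, with result μ.
record AdmissibleTransfer {n : ℕ} (κ : Partition n) (c a : Cell) (μ : Partition n) : Set where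
  field
    removable     : RemovableCorner κ c
    addable       : AddableCorner κ a
    distinct-rows : row c ≢ row a
    result        : μ isReorderingOf moveCell (row c) (row a) (parts κ)
    changed       : μ ≢ κ

{-# OPTIONS --safe #-}
module Submission where

-- Record a partition by its column lengths.  Moving the last cell of a row of length p + 1 to a row
-- of length q moves one cell from column p to column q, and since corners of a partition are
-- determined by their columns, an admissible transfer is the same as such a pair p ≠ q.  If μ₁ and μ₂
-- are adjacent, then their column lengths differ by a single such move; this forces one of the moves
-- κ → μ₁, κ → μ₂ to share its source or its target column with the other.  Conversely, with a common
-- source the cell put at a₁ can be moved on to a₂, and with a common target the cell c₂ can be used
-- to refill c₁.

open import Defs
open import Data.List.Base using (List; []; _∷_; [_]; _++_; length; filter; map)
open import Data.List.Membership.Propositional using (_∈_)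
open import Data.List.Properties using (filter-all; filter-++; filter-idem)
open import Data.List.Relation.Binary.Equality.Propositional using (≋⇒≡)
open import Data.List.Relation.Binary.Permutation.Propositional
  using (_↭_; refl; prep; swap; ↭-trans; ↭-sym; ↭-reflexive; ↭⇒↭ₛ)
open import Data.List.Relation.Binary.Permutation.Propositional.Properties
  using (map⁺; shift; drop-∷; ∷↭∷ʳ; ∈-resp-↭; filter-↭)
open import Data.List.Relation.Unary.All as All using (All; []; _∷_)
open import Data.List.Relation.Unary.Any using (here; there)
open import Data.List.Relation.Unary.Linked as Linked using (Linked; []; [-]; _∷_)
open import Data.List.Relation.Unary.Sorted.TotalOrder.Properties using (↗↭↗⇒≋)
open import Data.Nat.Base
open import Data.Nat.ListAction using (sum)
open import Data.Nat.ListAction.Properties using (sum-↭)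
open import Data.Nat.Properties
open import Data.Nat.Tactic.RingSolver using (solve-∀)
open import Data.Product.Base using (∃-syntax; _×_; _,_; proj₁)
open import Data.Sum.Base as Sum using (_⊎_; inj₁; inj₂)
open import Function.Base using (id; _∘_)
open import Function.Bundles using (_⇔_; mk⇔; Equivalence)
import Relation.Binary.Construct.Flip.EqAndOrd as Flip
open import Relation.Binary.Definitions using (tri<; tri≈; tri>)
open import Relation.Binary.PropositionalEquality
  using (_≡_; _≢_; refl; sym; trans; cong; cong₂; subst; ≢-sym; module ≡-Reasoning)
open import Relation.Nullary.Negation.Core using (contradiction)

-- Equality of partitions.

parts-injective : ∀ {n} {κ μ : Partition n} → parts κ ≡ parts μ → κ ≡ μ
parts-injective
  {κ = record { decreasing = d ; positive = p ; sum≡n = s }}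
  {μ = record { decreasing = d′ ; positive = p′ ; sum≡n = s′ }} refl
  with refl ← Linked.irrelevant ≤-irrelevant d d′
     | refl ← All.irrelevant ≤-irrelevant p p′
     | refl ← ≡-irrelevant s s′ = refl

-- Both lists of parts are sorted for the flipped order, and rearranging a sorted list into a sorted
-- list leaves it unchanged.
↭⇒≡ : ∀ {n} {κ μ : Partition n} → parts κ ↭ parts μ → κ ≡ μ
↭⇒≡ {κ = κ} {μ} p = parts-injective
  (≋⇒≡ (↗↭↗⇒≋ (Flip.totalOrder ≤-totalOrder) (decreasing κ) (decreasing μ) (↭⇒↭ₛ p)))

-- Row lengths and updates of single rows.

rowLength-antitone : ∀ {xs} → Linked _≥_ xs → ∀ {i j} → i ≤ j → rowLength xs j ≤ rowLength xs i
rowLength-antitone []         _          = z≤n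
rowLength-antitone [-]        {zero}  {zero}  _         = ≤-refl
rowLength-antitone [-]        {_}     {suc _} _         = z≤n
rowLength-antitone (_ ∷ _)    {zero}  {zero}  _         = ≤-refl
rowLength-antitone (x≥y ∷ ys) {zero}  {suc j} _         =
  ≤-trans (rowLength-antitone ys {zero} {j} z≤n) x≥y
rowLength-antitone (_ ∷ ys)   {suc _} {suc _} (s≤s i≤j) = rowLength-antitone ys i≤j

rowLength>0⇒<length : ∀ xs {i} → rowLength xs i > 0 → i < length xs
rowLength>0⇒<length (_ ∷ _)  {zero}  _ = s≤s z≤n
rowLength>0⇒<length (_ ∷ xs) {suc _} r = s≤s (rowLength>0⇒<length xs r)

rowLength-positive : ∀ {xs} → All (_> 0) xs → ∀ {i} → i < length xs → rowLength xs i > 0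
rowLength-positive (x>0 ∷ _)  {zero}  _       = x>0
rowLength-positive (_ ∷ xs>0) {suc _} (s≤s i<) = rowLength-positive xs>0 i<

rowLength-pad : ∀ xs i → rowLength (xs ++ [ 0 ]) i ≡ rowLength xs i
rowLength-pad []       zero    = refl
rowLength-pad []       (suc _) = refl
rowLength-pad (_ ∷ _)  zero    = refl
rowLength-pad (_ ∷ xs) (suc i) = rowLength-pad xs i

length-pad : ∀ (xs : List ℕ) → length (xs ++ [ 0 ]) ≡ suc (length xs)
length-pad []       = refl
length-pad (_ ∷ xs) = cong suc (length-pad xs)

length-updateRow : ∀ f i xs → length (updateRow f i xs) ≡ length xs
length-updateRow f _       []       = refl
length-updateRow f zero    (_ ∷ _)  = refl
length-updateRow f (suc i) (_ ∷ xs) = cong suc (length-updateRow f i xs)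

rowLength-updateRow : ∀ f i xs → i < length xs → rowLength (updateRow f i xs) i ≡ f (rowLength xs i)
rowLength-updateRow f zero    (_ ∷ _)  _        = refl
rowLength-updateRow f (suc i) (_ ∷ xs) (s≤s i<) = rowLength-updateRow f i xs i<

rowLength-updateRow-≢ : ∀ f {i j} xs → i ≢ j → rowLength (updateRow f i xs) j ≡ rowLength xs j
rowLength-updateRow-≢ f                 []       _   = refl
rowLength-updateRow-≢ f {zero}  {zero}  (_ ∷ _)  i≢j = contradiction refl i≢j
rowLength-updateRow-≢ f {zero}  {suc _} (_ ∷ _)  _   = refl
rowLength-updateRow-≢ f {suc _} {zero}  (_ ∷ _)  _   = refl
rowLength-updateRow-≢ f {suc _} {suc _} (_ ∷ xs) i≢j = rowLength-updateRow-≢ f xs (i≢j ∘ cong suc)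

updateRow-fix : ∀ f i xs → f (rowLength xs i) ≡ rowLength xs i → updateRow f i xs ≡ xs
updateRow-fix f _       []       _  = refl
updateRow-fix f zero    (_ ∷ xs) eq = cong (_∷ xs) eq
updateRow-fix f (suc i) (x ∷ xs) eq = cong (x ∷_) (updateRow-fix f i xs eq)

updateRow-∘ : ∀ g f i xs → updateRow g i (updateRow f i xs) ≡ updateRow (g ∘ f) i xs
updateRow-∘ g f _       []       = refl
updateRow-∘ g f zero    (_ ∷ _)  = refl
updateRow-∘ g f (suc i) (x ∷ xs) = cong (x ∷_) (updateRow-∘ g f i xs)

updateRow-cancel : ∀ g f i xs → g (f (rowLength xs i)) ≡ rowLength xs i →
                   updateRow g i (updateRow f i xs) ≡ xs
updateRow-cancel g f i xs eq = trans (updateRow-∘ g f i xs) (updateRow-fix (g ∘ f) i xs eq)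

updateRow-comm : ∀ f g {i j} xs → i ≢ j →
                 updateRow f i (updateRow g j xs) ≡ updateRow g j (updateRow f i xs)
updateRow-comm f g                 []       _   = refl
updateRow-comm f g {zero}  {zero}  (_ ∷ _)  i≢j = contradiction refl i≢j
updateRow-comm f g {zero}  {suc _} (_ ∷ _)  _   = refl
updateRow-comm f g {suc _} {zero}  (_ ∷ _)  _   = refl
updateRow-comm f g {suc _} {suc _} (x ∷ xs) i≢j = cong (x ∷_) (updateRow-comm f g xs (i≢j ∘ cong suc))

-- Reordering of row lengths, and cell moves up to reordering.

removeRow : ℕ → List ℕ → List ℕ
removeRow _       []       = []
removeRow zero    (_ ∷ xs) = xs
removeRow (suc i) (x ∷ xs) = x ∷ removeRow i xs

updateRow-↭ : ∀ f {i} xs → i < length xs → updateRow f i xs ↭ f (rowLength xs i) ∷ removeRow i xs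
updateRow-↭ f {zero}  (_ ∷ xs) _        = refl
updateRow-↭ f {suc i} (x ∷ xs) (s≤s i<) = ↭-trans (prep x (updateRow-↭ f xs i<)) (swap x _ refl)

row-↭ : ∀ {i} xs → i < length xs → xs ↭ rowLength xs i ∷ removeRow i xs
row-↭ {i} xs i< = ↭-trans (↭-reflexive (sym (updateRow-fix id i xs refl))) (updateRow-↭ id xs i<)

-- `rest` is chosen before `f` and `g`, so one list of untouched rows serves both the original
-- lengths (`f` and `g` the identity) and the lengths after a move.
updateRow₂-↭ : ∀ {i j} xs → i < length xs → j < length xs → i ≢ j →
               ∃[ rest ] (∀ f g → updateRow g j (updateRow f i xs) ↭
                                  f (rowLength xs i) ∷ g (rowLength xs j) ∷ rest)
updateRow₂-↭ {zero}  {zero}  (_ ∷ _)  _        _        i≢j = contradiction refl i≢j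
updateRow₂-↭ {zero}  {suc j} (x ∷ xs) _        (s≤s j<) _   =
  removeRow j xs , λ f g → prep (f x) (updateRow-↭ g xs j<)
updateRow₂-↭ {suc i} {zero}  (x ∷ xs) (s≤s i<) _        _   =
  removeRow i xs , λ f g → ↭-trans (prep (g x) (updateRow-↭ f xs i<)) (swap (g x) _ refl)
updateRow₂-↭ {suc i} {suc j} (x ∷ xs) (s≤s i<) (s≤s j<) i≢j
  with rest , p ← updateRow₂-↭ xs i< j< (i≢j ∘ cong suc) =
  x ∷ rest , λ f g → ↭-trans (prep x (p f g)) (↭-sym (shift x (_ ∷ _ ∷ []) rest))

rows-↭ : ∀ {i j} xs {rest} →
         (∀ f g → updateRow g j (updateRow f i xs) ↭ f (rowLength xs i) ∷ g (rowLength xs j) ∷ rest) →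
         xs ↭ rowLength xs i ∷ rowLength xs j ∷ rest
rows-↭ {i} {j} xs p = ↭-trans
  (↭-reflexive (sym (trans (updateRow-fix id j _ refl) (updateRow-fix id i xs refl)))) (p id id)

∈⇒row : ∀ {u xs} → u ∈ xs → ∃[ i ] (i < length xs × rowLength xs i ≡ u)
∈⇒row (here refl) = 0 , s≤s z≤n , refl
∈⇒row (there u∈)  with i , i< , eq ← ∈⇒row u∈ = suc i , s≤s i< , eq

∈-removeRow : ∀ {v} i xs → v ∈ removeRow i xs →
              ∃[ j ] (j < length xs × i ≢ j × rowLength xs j ≡ v)
∈-removeRow zero    (_ ∷ _)  v∈ with j , j< , eq ← ∈⇒row v∈ = suc j , s≤s j< , (λ ()) , eq
∈-removeRow (suc i) (_ ∷ _)  (here refl) = 0 , s≤s z≤n , (λ ()) , refl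
∈-removeRow (suc i) (_ ∷ xs) (there v∈) with j , j< , i≢j , eq ← ∈-removeRow i xs v∈ =
  suc j , s≤s j< , i≢j ∘ suc-injective , eq

-- The second row is sought after the first has been removed, so the two indices differ even when
-- `u` and `v` are equal.
↭⇒rows : ∀ {u v rest} xs → xs ↭ u ∷ v ∷ rest →
         ∃[ i ] ∃[ j ] (i < length xs × j < length xs × i ≢ j × rowLength xs i ≡ u × rowLength xs j ≡ v)
↭⇒rows xs p with i , i< , refl ← ∈⇒row (∈-resp-↭ (↭-sym p) (here refl))
  with j , j< , i≢j , eq ← ∈-removeRow i xs
         (∈-resp-↭ (drop-∷ (↭-trans (↭-sym p) (row-↭ xs i<))) (here refl)) =
  i , j , i< , j< , i≢j , refl , eq

-- The zero appended by moveCell takes over the row v that the filter drops when v = 0.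
pad-↭ : ∀ {p v rest xs} → xs ↭ filter (0 <?_) (suc p ∷ v ∷ rest) →
        ∃[ rest′ ] (xs ++ [ 0 ] ↭ suc p ∷ v ∷ rest′ × filter (0 <?_) rest′ ≡ filter (0 <?_) rest)
pad-↭ {p} {zero}  {rest} {xs} q = _ ,
  ↭-trans (↭-sym (∷↭∷ʳ 0 xs)) (↭-trans (prep 0 q) (swap 0 _ refl)) , filter-idem (0 <?_) rest
pad-↭ {p} {suc v} {rest} {xs} q = _ ,
  ↭-trans (↭-sym (∷↭∷ʳ 0 xs)) (↭-trans (prep 0 q) (↭-sym (shift 0 (_ ∷ _ ∷ []) _))) ,
  filter-idem (0 <?_) rest

-- `⟶` names rows of the sorted list `parts μ`, while `ys` may be unsorted and contain zeros. Rows
-- of the same lengths are therefore located in `parts μ ++ [ 0 ]`; moving a cell between them gives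
-- the same result up to order and zeros.
move⇒⟶ : ∀ {n p a b} {μ ν : Partition n} ys → a < length ys → b < length ys → a ≢ b →
         rowLength ys a ≡ suc p →
         μ isReorderingOf ys → ν isReorderingOf updateRow suc b (updateRow pred a ys) → μ ⟶ ν
move⇒⟶ {p = p} {a} {b} {μ} {ν} ys a< b< a≢b a≡ rμ rν
  with rest , upd ← updateRow₂-↭ ys a< b< a≢b
  with ys↭ ← rows-↭ ys upd
  rewrite a≡
  with rest′ , padμ↭ , rest≡ ← pad-↭ (↭-trans rμ (filter-↭ (0 <?_) ys↭))
  with i , j , i< , j< , i≢j , i≡ , j≡ ← ↭⇒rows (parts μ ++ [ 0 ]) padμ↭
  with rest″ , upd″ ← updateRow₂-↭ (parts μ ++ [ 0 ]) i< j< i≢j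
  with padμ↭″ ← rows-↭ (parts μ ++ [ 0 ]) upd″
  rewrite i≡ | j≡ =
  i , j ,
  -- Row `i` is nonempty, hence not the appended zero; row `j` may be that zero, which is why its
  -- bound is not strict.
  rowLength>0⇒<length (parts μ) (subst (_> 0) (trans (sym i≡) (rowLength-pad (parts μ) i)) (s≤s z≤n)) ,
  s≤s⁻¹ (subst (j <_) (length-pad (parts μ)) j<) ,
  i≢j ,
  ↭-trans rν (↭-trans (filter-↭ (0 <?_) (upd pred suc))
    (↭-trans (↭-reflexive same) (filter-↭ (0 <?_) (↭-sym (↭-trans (upd″ pred suc)
      -- Both descriptions of the padded list start with the same two lengths, so `rest″` and
      -- `rest′` are permutations of each other.
      (prep _ (prep _ (drop-∷ (drop-∷ (↭-trans (↭-sym padμ↭″) padμ↭))))))))))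
  where
  v = rowLength ys b
  same : filter (0 <?_) (p ∷ suc v ∷ rest) ≡ filter (0 <?_) (p ∷ suc v ∷ rest′)
  same = trans (filter-++ (0 <?_) (p ∷ suc v ∷ []) rest)
    (trans (cong (filter (0 <?_) (p ∷ suc v ∷ []) ++_) (sym rest≡))
      (sym (filter-++ (0 <?_) (p ∷ suc v ∷ []) rest′)))

moveCell-↭ : ∀ {i j} xs → i < length xs → j ≤ length xs → i ≢ j →
             ∃[ rest ] (xs ++ [ 0 ] ↭ rowLength xs i ∷ rowLength xs j ∷ rest ×
                        moveCell i j xs ↭ pred (rowLength xs i) ∷ suc (rowLength xs j) ∷ rest)
moveCell-↭ {i} {j} xs i< j≤ i≢j
  with rest , upd ← updateRow₂-↭ (xs ++ [ 0 ]) (subst (i <_) (sym (length-pad xs)) (m<n⇒m<1+n i<))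
                      (subst (j <_) (sym (length-pad xs)) (s≤s j≤)) i≢j
  with zs↭ ← rows-↭ (xs ++ [ 0 ]) upd
  rewrite rowLength-pad xs i | rowLength-pad xs j = rest , zs↭ , upd pred suc

-- Column lengths and transfers between columns.

⟦_<_⟧ : ℕ → ℕ → ℕ
⟦ _     < zero  ⟧ = 0
⟦ zero  < suc _ ⟧ = 1
⟦ suc m < suc x ⟧ = ⟦ m < x ⟧

⟦_≡_⟧ : ℕ → ℕ → ℕ
⟦ zero  ≡ zero  ⟧ = 1
⟦ zero  ≡ suc _ ⟧ = 0
⟦ suc _ ≡ zero  ⟧ = 0
⟦ suc m ≡ suc x ⟧ = ⟦ m ≡ x ⟧

-- Lengthening a row from `x` to `suc x` adds a cell in column `x` only.
⟦<suc⟧ : ∀ m x → ⟦ m < suc x ⟧ ≡ ⟦ m ≡ x ⟧ + ⟦ m < x ⟧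
⟦<suc⟧ zero    zero    = refl
⟦<suc⟧ zero    (suc _) = refl
⟦<suc⟧ (suc _) zero    = refl
⟦<suc⟧ (suc m) (suc x) = ⟦<suc⟧ m x

⟦≡⟧-refl : ∀ m → ⟦ m ≡ m ⟧ ≡ 1
⟦≡⟧-refl zero    = refl
⟦≡⟧-refl (suc m) = ⟦≡⟧-refl m

⟦≡⟧-cases : ∀ m x → m ≡ x ⊎ ⟦ m ≡ x ⟧ ≡ 0
⟦≡⟧-cases zero    zero    = inj₁ refl
⟦≡⟧-cases zero    (suc _) = inj₂ refl
⟦≡⟧-cases (suc _) zero    = inj₂ refl
⟦≡⟧-cases (suc m) (suc x) = Sum.map₁ (cong suc) (⟦≡⟧-cases m x)

-- These are the parts of the conjugate partition: a row of length `x` meets column `m` exactly when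
-- `m < x`. They ignore the order of the rows, so the sorting after a move leaves no trace.
columnLength : List ℕ → ℕ → ℕ
columnLength xs m = sum (map ⟦ m <_⟧ xs)

columnLength-↭ : ∀ {xs ys} m → xs ↭ ys → columnLength xs m ≡ columnLength ys m
columnLength-↭ m p = sum-↭ (map⁺ ⟦ m <_⟧ p)

columnLength-filter : ∀ m xs → columnLength (filter (0 <?_) xs) m ≡ columnLength xs m
columnLength-filter m []           = refl
columnLength-filter m (zero ∷ xs)  = columnLength-filter m xs
columnLength-filter m (suc x ∷ xs) = cong (⟦ m < suc x ⟧ +_) (columnLength-filter m xs)

-- One cell moves from column p to column q, stated without subtraction.
ColumnTransfer : ∀ {n} → Partition n → ℕ → ℕ → Partition n → Set
ColumnTransfer κ p q μ =
  ∀ m → ⟦ m ≡ p ⟧ + columnLength (parts μ) m ≡ ⟦ m ≡ q ⟧ + columnLength (parts κ) m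

-- The row of length `suc p` loses its cell in column `p`, the target row gains one in the column
-- numbered by its old length, and the other rows contribute the same amount before and after.
moveCell⇒columnTransfer : ∀ {n i j p} {κ μ : Partition n} →
  i < length (parts κ) → j ≤ length (parts κ) → i ≢ j → rowLength (parts κ) i ≡ suc p →
  μ isReorderingOf moveCell i j (parts κ) → ColumnTransfer κ p (rowLength (parts κ) j) μ
moveCell⇒columnTransfer {i = i} {j} {p} {κ} {μ} i< j≤ i≢j i≡ r m
  with rest , κ↭ , μ↭ ← moveCell-↭ (parts κ) i< j≤ i≢j rewrite i≡ =
  let
    q = rowLength (parts κ) j
    R = columnLength rest m
    κ-column : columnLength (parts κ) m ≡ ⟦ m < suc p ⟧ + (⟦ m < q ⟧ + R)
    κ-column = columnLength-↭ m (↭-trans (∷↭∷ʳ 0 (parts κ)) κ↭)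
    μ-column : columnLength (parts μ) m ≡ ⟦ m < p ⟧ + (⟦ m < suc q ⟧ + R)
    μ-column = trans (columnLength-↭ m r)
      (trans (columnLength-filter m (moveCell i j (parts κ))) (columnLength-↭ m μ↭))
  in begin
    ⟦ m ≡ p ⟧ + columnLength (parts μ) m
      ≡⟨ cong (⟦ m ≡ p ⟧ +_) μ-column ⟩
    ⟦ m ≡ p ⟧ + (⟦ m < p ⟧ + (⟦ m < suc q ⟧ + R))
      ≡⟨ cong (λ t → ⟦ m ≡ p ⟧ + (⟦ m < p ⟧ + (t + R))) (⟦<suc⟧ m q) ⟩
    ⟦ m ≡ p ⟧ + (⟦ m < p ⟧ + (⟦ m ≡ q ⟧ + ⟦ m < q ⟧ + R))
      ≡⟨ rearrange ⟦ m ≡ p ⟧ ⟦ m < p ⟧ ⟦ m ≡ q ⟧ ⟦ m < q ⟧ R ⟩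
    ⟦ m ≡ q ⟧ + (⟦ m ≡ p ⟧ + ⟦ m < p ⟧ + (⟦ m < q ⟧ + R))
      ≡⟨ cong (λ t → ⟦ m ≡ q ⟧ + (t + (⟦ m < q ⟧ + R))) (⟦<suc⟧ m p) ⟨
    ⟦ m ≡ q ⟧ + (⟦ m < suc p ⟧ + (⟦ m < q ⟧ + R))
      ≡⟨ cong (⟦ m ≡ q ⟧ +_) κ-column ⟨
    ⟦ m ≡ q ⟧ + columnLength (parts κ) m ∎
  where
  open ≡-Reasoning
  rearrange : ∀ a b c d e → a + (b + (c + d + e)) ≡ c + (a + b + (d + e))
  rearrange = solve-∀

⟶⇒columnTransfer : ∀ {n} {κ μ : Partition n} → κ ⟶ μ → ∃[ p ] ∃[ q ] ColumnTransfer κ p q μ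
⟶⇒columnTransfer {κ = κ} {μ} (i , j , i< , j≤ , i≢j , r) = _ , _ ,
  moveCell⇒columnTransfer {κ = κ} {μ} i< j≤ i≢j
    -- Rows of a partition are nonempty, so the length of row `i` is a successor, and its
    -- predecessor is the source column.
    (sym (suc-pred _ {{>-nonZero (rowLength-positive (positive κ) i<)}})) r

-- Adding the equations for `κ` to `μ`, `μ` to `ν` and the reverse of `κ` to `ν`, each of the three
-- column lengths occurs once on either side and cancels.
columnTransfers-balance : ∀ {n p₁ q₁ p₂ q₂ p q} {κ μ ν : Partition n} →
  ColumnTransfer κ p₁ q₁ μ → ColumnTransfer κ p₂ q₂ ν → ColumnTransfer μ p q ν →
  ∀ m → ⟦ m ≡ q₁ ⟧ + (⟦ m ≡ q ⟧ + ⟦ m ≡ p₂ ⟧) ≡ ⟦ m ≡ q₂ ⟧ + (⟦ m ≡ p ⟧ + ⟦ m ≡ p₁ ⟧)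
columnTransfers-balance {p₁ = p₁} {q₁} {p₂} {q₂} {p} {q} {κ} {μ} {ν} κμ κν μν m =
  +-cancelʳ-≡ (k + u + v) _ _ (begin
    (⟦ m ≡ q₁ ⟧ + (⟦ m ≡ q ⟧ + ⟦ m ≡ p₂ ⟧)) + (k + u + v)
      ≡⟨ left ⟦ m ≡ q₁ ⟧ ⟦ m ≡ q ⟧ ⟦ m ≡ p₂ ⟧ k u v ⟩
    (⟦ m ≡ q₁ ⟧ + k) + (⟦ m ≡ q ⟧ + u) + (⟦ m ≡ p₂ ⟧ + v)
      ≡⟨ cong₂ _+_ (cong₂ _+_ (κμ m) (μν m)) (sym (κν m)) ⟨
    (⟦ m ≡ p₁ ⟧ + u) + (⟦ m ≡ p ⟧ + v) + (⟦ m ≡ q₂ ⟧ + k)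
      ≡⟨ right ⟦ m ≡ p₁ ⟧ ⟦ m ≡ p ⟧ ⟦ m ≡ q₂ ⟧ k u v ⟩
    (⟦ m ≡ q₂ ⟧ + (⟦ m ≡ p ⟧ + ⟦ m ≡ p₁ ⟧)) + (k + u + v) ∎)
  where
  open ≡-Reasoning
  k = columnLength (parts κ) m
  u = columnLength (parts μ) m
  v = columnLength (parts ν) m
  left : ∀ a b c k u v → (a + (b + c)) + (k + u + v) ≡ (a + k) + (b + u) + (c + v)
  left = solve-∀
  right : ∀ a b c k u v → (a + u) + (b + v) + (c + k) ≡ (c + (b + a)) + (k + u + v)
  right = solve-∀

-- The balance equation says that {q₁, q, p₂} and {q₂, p, p₁} agree as multisets.
columnTransfers-meet : ∀ {n p₁ q₁ p₂ q₂ p q} {κ μ ν : Partition n} → p₁ ≢ q₁ → p₂ ≢ q₂ →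
  ColumnTransfer κ p₁ q₁ μ → ColumnTransfer κ p₂ q₂ ν → ColumnTransfer μ p q ν →
  p₁ ≡ p₂ ⊎ q₁ ≡ q₂
columnTransfers-meet {p₁ = p₁} {q₁} {p₂} {q₂} {p} {q} {κ} {μ} {ν} p₁≢q₁ p₂≢q₂ κμ κν μν
  with balance ← columnTransfers-balance {κ = κ} {μ} {ν} κμ κν μν
  -- At `m = q₁` the left side of the balance is at least 1, so `q₁` must equal `q₂`, `p₁` or `p`.
  with ⟦≡⟧-cases q₁ q₂ | ⟦≡⟧-cases q₁ p₁ | ⟦≡⟧-cases q₁ p
... | inj₁ q₁≡q₂ | _          | _         = inj₂ q₁≡q₂
... | inj₂ _     | inj₁ q₁≡p₁ | _         = contradiction (sym q₁≡p₁) p₁≢q₁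
... | inj₂ e     | inj₂ e₁    | inj₂ e₂   = contradiction eq λ ()
  where
  eq : 1 + (⟦ q₁ ≡ q ⟧ + ⟦ q₁ ≡ p₂ ⟧) ≡ 0
  eq = trans (cong (_+ (⟦ q₁ ≡ q ⟧ + ⟦ q₁ ≡ p₂ ⟧)) (sym (⟦≡⟧-refl q₁)))
    (trans (balance q₁) (cong₂ _+_ e (cong₂ _+_ e₂ e₁)))
-- Now `q₁` and `p` cancel from the balance, which at `m = p₂` forces `p₂` to equal `q₂` or `p₁`.
... | inj₂ _     | inj₂ _     | inj₁ refl with ⟦≡⟧-cases p₂ q₂ | ⟦≡⟧-cases p₂ p₁
...   | inj₁ p₂≡q₂ | _          = contradiction p₂≡q₂ p₂≢q₂
...   | inj₂ _     | inj₁ p₂≡p₁ = inj₁ (sym p₂≡p₁)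
...   | inj₂ e     | inj₂ e₁    = contradiction (trans (+-comm 1 _) eq) λ ()
  where
  eq : ⟦ p₂ ≡ q ⟧ + 1 ≡ 0
  eq = +-cancelˡ-≡ ⟦ p₂ ≡ q₁ ⟧ _ _
    (trans (cong (λ t → ⟦ p₂ ≡ q₁ ⟧ + (⟦ p₂ ≡ q ⟧ + t)) (sym (⟦≡⟧-refl p₂)))
      (trans (balance p₂) (cong₂ (λ s t → s + (⟦ p₂ ≡ q₁ ⟧ + t)) e e₁)))

-- Removable and addable corners, and their columns.

removable-row-< : ∀ {n} {κ : Partition n} {c} → RemovableCorner κ c → row c < length (parts κ)
removable-row-< {κ = κ} (eq , _) = rowLength>0⇒<length (parts κ) (subst (_> 0) eq (s≤s z≤n))

-- All rows below that of a removable corner are strictly shorter, so removable corners in distinct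
-- rows lie in distinct columns.
removable-unique : ∀ {n} {κ : Partition n} {c d} → RemovableCorner κ c → RemovableCorner κ d →
                   col c ≡ col d → c ≡ d
removable-unique {κ = κ} {i , x} {j , _} (c≡ , c>) (d≡ , d>) refl with <-cmp i j
... | tri≈ _ refl _ = refl
... | tri< i<j _ _  = contradiction (trans (sym d≡) c≡)
  (<⇒≢ (≤-<-trans (rowLength-antitone (decreasing κ) i<j) c>))
... | tri> _ _ j<i  = contradiction (trans (sym c≡) d≡)
  (<⇒≢ (≤-<-trans (rowLength-antitone (decreasing κ) j<i) d>))

-- The enlarged diagram `ν` contains the cells above `a` in its column, and `a` is the only cell of
-- `ν` outside `κ`.
addable-above : ∀ {n} {κ : Partition n} {a} → AddableCorner κ a →
                ∀ {i} → i < row a → (i , col a) ∈F κ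
addable-above {a = a} (_ , _ , ν , cells) {i} i<
  with Equivalence.to (cells (i , col a))
         (<-≤-trans (Equivalence.from (cells a) (inj₂ refl)) (rowLength-antitone (decreasing ν) (<⇒≤ i<)))
... | inj₁ ∈κ = ∈κ
... | inj₂ eq = contradiction (cong row eq) (<⇒≢ i<)

-- Since `a` is not in `κ`, the row has length at most `col a`; the cells to the left of `a` lie in
-- `ν` and differ from `a`, which gives the reverse bound.
addable-col : ∀ {n} {κ : Partition n} {a} → AddableCorner κ a → rowLength (parts κ) (row a) ≡ col a
addable-col {κ = κ} {i , x} (a∉ , _ , ν , cells) = ≤-antisym (≮⇒≥ a∉) (lower x ≤-refl)
  where
  lower : ∀ y → y ≤ x → y ≤ rowLength (parts κ) i
  lower zero    _   = z≤n
  lower (suc y) y<x with Equivalence.to (cells (i , y))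
                           (<-trans y<x (Equivalence.from (cells (i , x)) (inj₂ refl)))
  ... | inj₁ ∈κ = ∈κ
  ... | inj₂ eq = contradiction (cong col eq) (<⇒≢ y<x)

addable-row-≤ : ∀ {n} {κ : Partition n} {a} → AddableCorner κ a → row a ≤ length (parts κ)
addable-row-≤ {a = zero  , _} _   = z≤n
addable-row-≤ {κ = κ} {suc i , x} add =
  rowLength>0⇒<length (parts κ) (≤-<-trans z≤n (addable-above {κ = κ} add ≤-refl))

-- The higher of two addable corners in one column would already be a cell of `κ`.
addable-unique : ∀ {n} {κ : Partition n} {a b} → AddableCorner κ a → AddableCorner κ b →
                 col a ≡ col b → a ≡ b
addable-unique {κ = κ} {i , _} {j , _} a b refl with <-cmp i j
... | tri≈ _ refl _ = refl
... | tri< i<j _ _  = contradiction (addable-above {κ = κ} b i<j) (proj₁ a)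
... | tri> _ _ j<i  = contradiction (addable-above {κ = κ} a j<i) (proj₁ b)

-- Admissible transfers as moves between columns.

module _ {n} {κ : Partition n} {c a μ} (t : AdmissibleTransfer κ c a μ) where
  open AdmissibleTransfer t

  admissible⇒columnTransfer : ColumnTransfer κ (col c) (col a) μ
  admissible⇒columnTransfer = subst (λ q → ColumnTransfer κ (col c) q μ) (addable-col {κ = κ} addable)
    (moveCell⇒columnTransfer {κ = κ} {μ} (removable-row-< {κ = κ} removable)
      (addable-row-≤ {κ = κ} addable) distinct-rows (sym (proj₁ removable)) result)

  -- If the columns agree, the move interchanges two row lengths p + 1 and p.
  admissible⇒col-≢ : col c ≢ col a
  admissible⇒col-≢ c≡a
    with rest , κ↭ , μ↭ ← moveCell-↭ (parts κ) (removable-row-< {κ = κ} removable)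
                            (addable-row-≤ {κ = κ} addable) distinct-rows
    rewrite sym (proj₁ removable) | addable-col {κ = κ} addable | c≡a =
    changed (↭⇒≡ (↭-trans result (↭-trans
      (filter-↭ (0 <?_) (↭-trans μ↭ (↭-trans (swap _ _ refl) (↭-trans (↭-sym κ↭) (↭-sym (∷↭∷ʳ 0 (parts κ)))))))
      (↭-reflexive (filter-all (0 <?_) (positive κ))))))

-- Two admissible transfers from one partition.

module _ {n} {κ : Partition n} {c₁ a₁ c₂ a₂ μ₁ μ₂}
         (t₁ : AdmissibleTransfer κ c₁ a₁ μ₁) (t₂ : AdmissibleTransfer κ c₂ a₂ μ₂) where
  private
    module T₁ = AdmissibleTransfer t₁
    module T₂ = AdmissibleTransfer t₂
    zs = parts κ ++ [ 0 ]

    removable-< : ∀ {c} → RemovableCorner κ c → row c < length zs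
    removable-< r = subst (_ <_) (sym (length-pad (parts κ))) (m<n⇒m<1+n (removable-row-< {κ = κ} r))

    addable-< : ∀ {a} → AddableCorner κ a → row a < length zs
    addable-< a = subst (_ <_) (sym (length-pad (parts κ))) (s≤s (addable-row-≤ {κ = κ} a))

    moved-< : ∀ i j {k} → k < length zs → k < length (moveCell i j (parts κ))
    moved-< i j = subst (_ <_)
      (sym (trans (length-updateRow suc j (updateRow pred i zs)) (length-updateRow pred i zs)))

  adjacent⇒common-corner : μ₁ ⟶ μ₂ → c₁ ≡ c₂ ⊎ a₁ ≡ a₂
  adjacent⇒common-corner μ₁⟶μ₂ with _ , _ , μ₁μ₂ ← ⟶⇒columnTransfer {κ = μ₁} {μ₂} μ₁⟶μ₂ =
    Sum.map (removable-unique {κ = κ} T₁.removable T₂.removable)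
            (addable-unique {κ = κ} T₁.addable T₂.addable)
            (columnTransfers-meet {κ = κ} {μ₁} {μ₂} (admissible⇒col-≢ t₁) (admissible⇒col-≢ t₂)
              (admissible⇒columnTransfer t₁) (admissible⇒columnTransfer t₂) μ₁μ₂)

  -- The second move is made on the list before sorting, where the added cell is still in row
  -- `row a₁`; `move⇒⟶` carries it over to the parts of `μ₁`.
  common-removable⇒adjacent : row c₁ ≡ row c₂ → μ₁ ≢ μ₂ → μ₁ ⟶ μ₂
  common-removable⇒adjacent refl μ₁≢μ₂ =
    move⇒⟶ {μ = μ₁} {μ₂} (moveCell i j₁ (parts κ))
      (moved-< i j₁ (addable-< T₁.addable)) (moved-< i j₁ (addable-< T₂.addable)) j₁≢j₂
      (rowLength-updateRow suc j₁ (updateRow pred i zs)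
        (subst (j₁ <_) (sym (length-updateRow pred i zs)) (addable-< T₁.addable)))
      T₁.result (subst (μ₂ isReorderingOf_) moves T₂.result)
    where
    i = row c₁
    j₁ = row a₁
    j₂ = row a₂
    j₁≢j₂ : j₁ ≢ j₂
    -- Equal target rows would make both results reorderings of one list.
    j₁≢j₂ eq = μ₁≢μ₂ (↭⇒≡ (↭-trans T₁.result
      (↭-trans (↭-reflexive (cong (λ j → filter (0 <?_) (moveCell i j (parts κ))) eq)) (↭-sym T₂.result))))
    moves : moveCell i j₂ (parts κ) ≡ updateRow suc j₂ (updateRow pred j₁ (moveCell i j₁ (parts κ)))
    -- Taking the cell back from row `j₁` undoes the first addition and leaves only the removal from
    -- row `i`.
    moves = cong (updateRow suc j₂) (sym (updateRow-cancel pred suc j₁ (updateRow pred i zs) refl))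

  common-addable⇒adjacent : row a₁ ≡ row a₂ → μ₁ ≢ μ₂ → μ₁ ⟶ μ₂
  common-addable⇒adjacent refl μ₁≢μ₂ =
    move⇒⟶ {μ = μ₁} {μ₂} (moveCell i₁ j (parts κ))
      (moved-< i₁ j (removable-< T₂.removable)) (moved-< i₁ j (removable-< T₁.removable)) (≢-sym i₁≢i₂)
      i₂-length T₁.result (subst (μ₂ isReorderingOf_) (sym moves) T₂.result)
    where
    open ≡-Reasoning
    i₁ = row c₁
    i₂ = row c₂
    j = row a₁
    i₁≢i₂ : i₁ ≢ i₂
    i₁≢i₂ eq = μ₁≢μ₂ (↭⇒≡ (↭-trans T₁.result
      (↭-trans (↭-reflexive (cong (λ i → filter (0 <?_) (moveCell i j (parts κ))) eq)) (↭-sym T₂.result))))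
    i₂-length : rowLength (moveCell i₁ j (parts κ)) i₂ ≡ suc (col c₂)
    i₂-length = begin
      rowLength (moveCell i₁ j (parts κ)) i₂ ≡⟨ rowLength-updateRow-≢ suc (updateRow pred i₁ zs) (≢-sym T₂.distinct-rows) ⟩
      rowLength (updateRow pred i₁ zs) i₂    ≡⟨ rowLength-updateRow-≢ pred zs i₁≢i₂ ⟩
      rowLength zs i₂                        ≡⟨ rowLength-pad (parts κ) i₂ ⟩
      rowLength (parts κ) i₂                 ≡⟨ proj₁ T₂.removable ⟨
      suc (col c₂)                           ∎
    -- `suc` undoes `pred` only on a nonempty row, and row `i₁` contains `c₁`.
    i₁-length : suc (pred (rowLength zs i₁)) ≡ rowLength zs i₁
    i₁-length rewrite rowLength-pad (parts κ) i₁ | sym (proj₁ T₁.removable) = refl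
    moves : updateRow suc i₁ (updateRow pred i₂ (moveCell i₁ j (parts κ))) ≡ moveCell i₂ j (parts κ)
    -- The refilling of row `i₁` is brought inward past the updates of other rows until it cancels
    -- the removal from that row.
    moves = begin
      updateRow suc i₁ (updateRow pred i₂ (updateRow suc j (updateRow pred i₁ zs)))
        ≡⟨ cong (updateRow suc i₁) (updateRow-comm pred suc (updateRow pred i₁ zs) T₂.distinct-rows) ⟩
      updateRow suc i₁ (updateRow suc j (updateRow pred i₂ (updateRow pred i₁ zs)))
        ≡⟨ updateRow-comm suc suc (updateRow pred i₂ (updateRow pred i₁ zs)) T₁.distinct-rows ⟩
      updateRow suc j (updateRow suc i₁ (updateRow pred i₂ (updateRow pred i₁ zs)))
        ≡⟨ cong (updateRow suc j) (updateRow-comm suc pred (updateRow pred i₁ zs) i₁≢i₂) ⟩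
      updateRow suc j (updateRow pred i₂ (updateRow suc i₁ (updateRow pred i₁ zs)))
        ≡⟨ cong (updateRow suc j ∘ updateRow pred i₂) (updateRow-cancel suc pred i₁ zs i₁-length) ⟩
      updateRow suc j (updateRow pred i₂ zs) ∎

theorem3p4 : (n : ℕ) → n ≥ 1 →
    (κ μ₁ μ₂ : Partition n) (c₁ a₁ c₂ a₂ : Cell) →
    AdmissibleTransfer κ c₁ a₁ μ₁ →
    AdmissibleTransfer κ c₂ a₂ μ₂ →
    μ₁ ≢ μ₂ →
    Triangle κ μ₁ μ₂ ⇔ (c₁ ≡ c₂ ⊎ a₁ ≡ a₂)
theorem3p4 n _ κ μ₁ μ₂ c₁ a₁ c₂ a₂ t₁ t₂ μ₁≢μ₂ = mk⇔ to from
  where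
  neighbour : ∀ {c a μ} → AdmissibleTransfer κ c a μ → κ ~ μ
  neighbour t = ≢-sym changed , inj₁ (_ , _ , removable-row-< {κ = κ} removable ,
    addable-row-≤ {κ = κ} addable , distinct-rows , result)
    where open AdmissibleTransfer t

  to : Triangle κ μ₁ μ₂ → c₁ ≡ c₂ ⊎ a₁ ≡ a₂
  to (_ , _ , _ , inj₁ μ₁⟶μ₂) = adjacent⇒common-corner t₁ t₂ μ₁⟶μ₂
  to (_ , _ , _ , inj₂ μ₂⟶μ₁) = Sum.map sym sym (adjacent⇒common-corner t₂ t₁ μ₂⟶μ₁)

  from : c₁ ≡ c₂ ⊎ a₁ ≡ a₂ → Triangle κ μ₁ μ₂
  from common = neighbour t₁ , neighbour t₂ , μ₁≢μ₂ , inj₁ (adjacent common)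
    where
    adjacent : c₁ ≡ c₂ ⊎ a₁ ≡ a₂ → μ₁ ⟶ μ₂
    adjacent (inj₁ c₁≡c₂) = common-removable⇒adjacent t₁ t₂ (cong row c₁≡c₂) μ₁≢μ₂
    adjacent (inj₂ a₁≡a₂) = common-addable⇒adjacent t₁ t₂ (cong row a₁≡a₂) μ₁≢μ₂
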